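{- Let $n\ge 3$ be an integer. For an $n\times n$ maximum arrangement of prisoners and guards, the number of prisoners, $P(n)$, satisfies the inequality $$P(n)\le \frac{7n^2+4n}{11}.$$
   Context: A configuration on an $n\times n$ board assigns to each of the $n^2$ squares exactly one occupant, either a prisoner or a guard. Two distinct squares are adjacent if one is directly above, below, to the left, to the right, or diagonal to the other (king-move adjacency). A configuration is valid (a valid board) if every square occupied by a prisoner is adjacent to at least as many squares occupied by guards as squares occupied by (other) prisoners. A maximum configuration (maximum arrangement) is a valid board that has the greatest number of prisoners among all valid boards on the $n\times n$ board. $P(n)$ denotes the number of prisoners in a maximum configuration on the $n\times n$ board. -}

module Defs where

open import Data.Fin using (Fin; toℕ)
open import Data.Fin.Properties using (all?) renaming (_≟_ to _≟ᶠ_)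
open import Data.List using (List; []; _∷_; allFin; cartesianProduct; cartesianProductWith; filter; length)
open import Data.List.Extrema.Nat using (argmax; argmax-all; f[xs]≤f[argmax])
open import Data.List.Membership.Propositional using (_∈_)
open import Data.List.Membership.Propositional.Properties
  using (∈-cartesianProductWith⁺; ∈-filter⁺)
open import Data.List.Relation.Unary.All as All using (All)
open import Data.List.Relation.Unary.All.Properties using (all-filter)
open import Data.List.Relation.Unary.Any using (here; there)
open import Data.Nat using (ℕ; zero; suc; _≤_; _≤?_; ∣_-_∣)
open import Data.Product using (∃; _×_; _,_; proj₁; proj₂)
open import Data.Product.Properties using (≡-dec)
open import Data.Vec using (Vec; []; _∷_; lookup; replicate)
open import Data.Vec.Properties using (lookup-replicate)
open import Relation.Binary.Definitions using (DecidableEquality)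
open import Relation.Binary.PropositionalEquality using (_≡_; _≢_; refl; sym; trans; cong)
open import Relation.Nullary using (Dec; yes; no; ¬?; contradiction)
open import Relation.Nullary.Decidable using (_×-dec_; _→-dec_; map′)

data Occupant : Set where
  prisoner guard : Occupant

_≟ᵒ_ : DecidableEquality Occupant
prisoner ≟ᵒ prisoner = yes refl
prisoner ≟ᵒ guard    = no λ ()
guard    ≟ᵒ prisoner = no λ ()
guard    ≟ᵒ guard    = yes refl

Square : ℕ → Set
Square n = Fin n × Fin n

squares : ∀ n → List (Square n)
squares n = cartesianProduct (allFin n) (allFin n)

_≟ˢ_ : ∀ {n} → DecidableEquality (Square n)
_≟ˢ_ = ≡-dec _≟ᶠ_ _≟ᶠ_

Adjacent : ∀ {n} → Square n → Square n → Set
Adjacent (i , j) (k , l) =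
  (i , j) ≢ (k , l) × ∣ toℕ i - toℕ k ∣ ≤ 1 × ∣ toℕ j - toℕ l ∣ ≤ 1

adjacent? : ∀ {n} (s t : Square n) → Dec (Adjacent s t)
adjacent? (i , j) (k , l) =
  ¬? ((i , j) ≟ˢ (k , l)) ×-dec ∣ toℕ i - toℕ k ∣ ≤? 1 ×-dec ∣ toℕ j - toℕ l ∣ ≤? 1

-- A vector of rows rather than a function on squares: the finitely many
-- configurations can then be listed without function extensionality.
Configuration : ℕ → Set
Configuration n = Vec (Vec Occupant n) n

occupant : ∀ {n} → Configuration n → Square n → Occupant
occupant c (i , j) = lookup (lookup c i) j

neighbours : ∀ {n} → Configuration n → Square n → Occupant → ℕ
neighbours {n} c s o =
  length (filter (λ t → adjacent? s t ×-dec occupant c t ≟ᵒ o) (squares n))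

prisoners : ∀ {n} → Configuration n → ℕ
prisoners {n} c = length (filter (λ s → occupant c s ≟ᵒ prisoner) (squares n))

Valid : ∀ {n} → Configuration n → Set
Valid {n} c = ∀ (s : Square n) → occupant c s ≡ prisoner →
  neighbours c s prisoner ≤ neighbours c s guard

Maximum : ∀ {n} → Configuration n → Set
Maximum {n} c = Valid c × (∀ (d : Configuration n) → Valid d → prisoners d ≤ prisoners c)

valid? : ∀ {n} (c : Configuration n) → Dec (Valid c)
valid? c = map′ (λ v (i , j) → v i j) (λ v i j → v (i , j))
  (all? λ i → all? λ j → (occupant c (i , j) ≟ᵒ prisoner) →-dec
    (neighbours c (i , j) prisoner ≤? neighbours c (i , j) guard))

vectors : ∀ {A : Set} → List A → ∀ n → List (Vec A n)
vectors xs zero    = [] ∷ []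
vectors xs (suc n) = cartesianProductWith _∷_ xs (vectors xs n)

vectors-complete : ∀ {A : Set} {xs : List A} → (∀ x → x ∈ xs) →
  ∀ {n} (v : Vec A n) → v ∈ vectors xs n
vectors-complete all∈ []      = here refl
vectors-complete all∈ (x ∷ v) =
  ∈-cartesianProductWith⁺ _∷_ (all∈ x) (vectors-complete all∈ v)

occupants : List Occupant
occupants = prisoner ∷ guard ∷ []

occupants-complete : ∀ o → o ∈ occupants
occupants-complete prisoner = here refl
occupants-complete guard    = there (here refl)

configurations : ∀ n → List (Configuration n)
configurations n = vectors (vectors occupants n) n

configurations-complete : ∀ {n} (c : Configuration n) → c ∈ configurations n
configurations-complete = vectors-complete (vectors-complete occupants-complete)

allGuards : ∀ n → Configuration n
allGuards n = replicate n (replicate n guard)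

allGuards-valid : ∀ n → Valid (allGuards n)
allGuards-valid n (i , j) p = contradiction (trans (sym p) guarded) λ ()
  where
  guarded : occupant (allGuards n) (i , j) ≡ guard
  guarded = trans (cong (λ r → lookup r j) (lookup-replicate i (replicate n guard)))
                  (lookup-replicate j guard)

maximumConfiguration : ∀ n → ∃ λ (c : Configuration n) → Maximum c
maximumConfiguration n = best , best-valid , best-greatest
  where
  candidates : List (Configuration n)
  candidates = filter valid? (configurations n)

  best : Configuration n
  best = argmax prisoners (allGuards n) candidates

  best-valid : Valid best
  best-valid = argmax-all prisoners (allGuards-valid n) (all-filter valid? (configurations n))

  best-greatest : ∀ d → Valid d → prisoners d ≤ prisoners best
  best-greatest d v = All.lookup (f[xs]≤f[argmax] (allGuards n) candidates)
    (∈-filter⁺ valid? (configurations-complete d) v)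

-- Independent of which maximum configuration is chosen: any two have equally
-- many prisoners, by the second component of Maximum.
P : ℕ → ℕ
P n = prisoners (proj₁ (maximumConfiguration n))

{-# OPTIONS --safe #-}
-- Write B f s for the sum of f over the 3 × 3 block around s, and p, g for the
-- indicators of prisoners and guards.  By symmetry of adjacency,
-- Σ p · B g = Σ g · B p.
--
-- Upper bound: Σ g · B p ≤ 7 Σ g.  If a guard at column c has eight prisoner
-- neighbours, validity at its right neighbour makes all three squares of the
-- block's column c + 2 guards; hence the guard at column c + 2 has at most six
-- prisoner neighbours, and can absorb the surplus of 1.  This transfer is
-- injective, so no guard absorbs more than once.
--
-- Lower bound: a prisoner sees at least 4 guards in the interior, 3 on an edge,
-- 2 in a corner; the deficits, charged to the 4n edge incidences of the board,
-- give 4 Σ p ≤ Σ p · B g + 4n.  Together with Σ p + Σ g = n² this is the bound.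
module Submission where

open import Defs
open import Data.Bool using (true; false; if_then_else_)
open import Data.Fin using (Fin; zero; suc; toℕ)
open import Data.Fin.Properties using () renaming (_≟_ to _≟ᶠ_)
open import Data.List using (_++_; map; tabulate; filter; length; cartesianProduct)
open import Data.List.Properties using (map-tabulate; filter-++; length-++)
open import Data.Nat using (ℕ; zero; suc; _+_; _*_; _∸_; _^_; _≥_; z≤n; s≤s; s≤s⁻¹; ∣_-_∣; _≤?_)
import Data.Integer as ℤ
import Data.Nat as ℕ
open import Data.Nat.Properties
open import Data.Nat.Tactic.RingSolver using (solve-∀)
open import Data.Product using (_×_; _,_; proj₁; proj₂)
open import Data.Rational.Unnormalised using (_/_; _≤_; *≤*)
open import Data.Sum using (_⊎_; inj₁; inj₂)
open import Function using (_∘_)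
open import Relation.Binary.PropositionalEquality
open import Relation.Nullary using (Dec; yes; no; does; ¬?; contradiction)
open import Relation.Nullary.Decidable using (_×-dec_)
open import Relation.Unary using (Decidable)

open import Algebra.Properties.Semiring.Sum +-*-semiring
  using (sum; sum-syntax; sum-cong-≗; ∑-comm; ∑-distrib-+; *-distribˡ-sum; *-distribʳ-sum)

private variable
  A : Set
  n : ℕ

-- Finite sums and counting over the board.

sum-mono : {f g : Fin n → ℕ} → (∀ i → f i ℕ.≤ g i) → sum f ℕ.≤ sum g
sum-mono {zero}  f≤g = z≤n
sum-mono {suc n} f≤g = +-mono-≤ (f≤g zero) (sum-mono (f≤g ∘ suc))

sum-const : ∀ n x → ∑[ i < n ] x ≡ n * x
sum-const zero    x = refl
sum-const (suc n) x = cong (x +_) (sum-const n x)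

sum-zero : {f : Fin n → ℕ} → (∀ i → f i ≡ 0) → sum f ≡ 0
sum-zero {n} f≡0 = trans (sum-cong-≗ f≡0) (trans (sum-const n 0) (*-zeroʳ n))

term≤sum : (f : Fin n → ℕ) → ∀ i → f i ℕ.≤ sum f
term≤sum f zero    = m≤m+n _ _
term≤sum f (suc i) = ≤-trans (term≤sum (f ∘ suc) i) (m≤n+m _ _)

∑-truncate : ∀ n {m} (h : ℕ → ℕ) → (∀ k → h (n + k) ≡ 0) →
  ∑[ k < n + m ] h (toℕ k) ≡ ∑[ k < n ] h (toℕ k)
∑-truncate zero {m} h h≡0 = sum-zero {m} (h≡0 ∘ toℕ)
∑-truncate (suc n)  h h≡0 = cong (h 0 +_) (∑-truncate n (h ∘ suc) h≡0)

-- Only the boolean is read, so that indicators of decisions built with `map′` or `×-dec` still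
-- compute.
⟦_⟧ : {P : Set} → Dec P → ℕ
⟦ d ⟧ = if does d then 1 else 0

length-filter-tabulate : {P : A → Set} (P? : Decidable P) (f : Fin n → A) →
  length (filter P? (tabulate f)) ≡ ∑[ i < n ] ⟦ P? (f i) ⟧
length-filter-tabulate {n = zero}  P? f = refl
length-filter-tabulate {n = suc n} P? f with does (P? (f zero))
... | true  = cong suc (length-filter-tabulate P? (f ∘ suc))
... | false = length-filter-tabulate P? (f ∘ suc)

-- The row labels come from an arbitrary `f` because the induction replaces `f` by `f ∘ suc`, while
-- the columns stay fixed.
length-filter-cartesianProduct : {P : Fin n × Fin n → Set} (P? : Decidable P) →
  ∀ {m} (f : Fin m → Fin n) →
  length (filter P? (cartesianProduct (tabulate f) (tabulate (λ j → j))))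
    ≡ ∑[ i < m ] ∑[ j < n ] ⟦ P? (f i , j) ⟧
length-filter-cartesianProduct P? {zero} f = refl
length-filter-cartesianProduct {n} P? {suc m} f = begin
  length (filter P? (row ++ rest))
    ≡⟨ cong length (filter-++ P? row rest) ⟩
  length (filter P? row ++ filter P? rest)
    ≡⟨ length-++ (filter P? row) ⟩
  length (filter P? row) + length (filter P? rest)
    ≡⟨ cong₂ _+_ (trans (cong (length ∘ filter P?) (map-tabulate (λ j → j) (f zero ,_)))
                        (length-filter-tabulate P? (f zero ,_)))
                 (length-filter-cartesianProduct P? (f ∘ suc)) ⟩
  _ ∎
  where
  open ≡-Reasoning
  row = map (f zero ,_) (tabulate (λ j → j))
  rest = cartesianProduct (tabulate (f ∘ suc)) (tabulate (λ j → j))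

count-squares : {P : Square n → Set} (P? : Decidable P) →
  length (filter P? (squares n)) ≡ ∑[ i < n ] ∑[ j < n ] ⟦ P? (i , j) ⟧
count-squares P? = length-filter-cartesianProduct P? (λ i → i)

-- The distance-one kernel as a sum of three consecutive entries.

nearℕ : ℕ → ℕ → ℕ
nearℕ i k = ⟦ ∣ i - k ∣ ≤? 1 ⟧

near : Fin n → Fin n → ℕ
near i k = nearℕ (toℕ i) (toℕ k)

near-sym : (i k : Fin n) → near i k ≡ near k i
near-sym i k = cong (λ d → ⟦ d ≤? 1 ⟧) (∣-∣-comm (toℕ i) (toℕ k))

near-refl : (i : Fin n) → near i i ≡ 1
near-refl zero    = refl
near-refl (suc i) = near-refl i

-- Entries off the board count 0, so that windows crossing the border need no separate treatment.
extend : (Fin n → ℕ) → ℕ → ℕ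
extend {zero}  f _       = 0
extend {suc n} f zero    = f zero
extend {suc n} f (suc k) = extend (f ∘ suc) k

-- Shifted by one, so that triple (pad f) k below is centred at entry k of f.
pad : (Fin n → ℕ) → ℕ → ℕ
pad f zero    = 0
pad f (suc k) = extend f k

extend-toℕ : (f : Fin n → ℕ) → ∀ i → extend f (toℕ i) ≡ f i
extend-toℕ f zero    = refl
extend-toℕ f (suc i) = extend-toℕ (f ∘ suc) i

extend-beyond : ∀ n (f : Fin n → ℕ) k → extend f (n + k) ≡ 0
extend-beyond zero    f k = refl
extend-beyond (suc n) f k = extend-beyond n (f ∘ suc) k

triple : (ℕ → ℕ) → ℕ → ℕ
triple h k = h k + h (1 + k) + h (2 + k)

near-zero-sum : (f : Fin n → ℕ) → ∑[ k < n ] (nearℕ 0 (toℕ k) * f k) ≡ extend f 0 + extend f 1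
near-zero-sum {zero} f = refl
near-zero-sum {suc zero} f = cong₂ _+_ (*-identityˡ (f zero)) refl
near-zero-sum {suc (suc n)} f = begin
  1 * f zero + (1 * f (suc zero) + sum {n} (λ _ → 0))
    ≡⟨ cong₂ _+_ (*-identityˡ (f zero)) (cong₂ _+_ (*-identityˡ (f (suc zero))) (sum-zero {n} (λ _ → refl))) ⟩
  f zero + (f (suc zero) + 0)
    ≡⟨ cong (f zero +_) (+-identityʳ _) ⟩
  f zero + f (suc zero) ∎
  where open ≡-Reasoning

-- Dropping the first entry shifts both sides alike. From index 2 on, the dropped term has weight 0
-- by computation; at index 1 it is the left entry of the triple; at index 0 the left entry is the
-- padding.
near-sum : (f : Fin n → ℕ) (i : Fin n) →
  ∑[ k < n ] (near i k * f k) ≡ triple (pad f) (toℕ i)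
near-sum f zero          = near-zero-sum f
near-sum f (suc zero)    = trans (cong₂ _+_ (*-identityˡ (f zero)) (near-sum (f ∘ suc) zero))
                                 (sym (+-assoc (f zero) _ _))
near-sum f (suc (suc i)) = near-sum (f ∘ suc) (suc i)

triple≤ : ∀ {c} (h : ℕ → ℕ) → (∀ k → h k ℕ.≤ c) → ∀ k → triple h k ℕ.≤ c + c + c
triple≤ h h≤c k = +-mono-≤ (+-mono-≤ (h≤c k) (h≤c (1 + k))) (h≤c (2 + k))

extend≤ : ∀ {c} (f : Fin n → ℕ) → (∀ i → f i ℕ.≤ c) → ∀ k → extend f k ℕ.≤ c
extend≤ {zero}  f f≤c k       = z≤n
extend≤ {suc n} f f≤c zero    = f≤c zero
extend≤ {suc n} f f≤c (suc k) = extend≤ (f ∘ suc) (f≤c ∘ suc) k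

-- Neighbourhood sizes and edge deficits on a line.

width : Fin n → ℕ
width {n} i = ∑[ k < n ] near i k

width≤3 : (i : Fin n) → width i ℕ.≤ 3
width≤3 {n} i = begin
  width i                       ≡⟨ sum-cong-≗ (λ k → sym (*-identityʳ (near i k))) ⟩
  sum (λ k → near i k * 1)      ≡⟨ near-sum (λ _ → 1) i ⟩
  triple (pad (λ _ → 1)) (toℕ i) ≤⟨ triple≤ (pad (λ _ → 1)) pad≤1 (toℕ i) ⟩
  3 ∎
  where
  open ≤-Reasoning
  pad≤1 : ∀ k → pad {n} (λ _ → 1) k ℕ.≤ 1
  pad≤1 zero    = z≤n
  pad≤1 (suc k) = extend≤ {n} (λ _ → 1) (λ _ → ≤-refl) k

2≤width : (i : Fin (2 + n)) → 2 ℕ.≤ width i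
2≤width zero = s≤s (s≤s z≤n)
2≤width {zero}  (suc zero) = ≤-refl
2≤width {suc n} (suc i)    = ≤-trans (2≤width i) (m≤n+m (width i) (nearℕ (suc (toℕ i)) 0))

-- Peeling the first row and column off the band matrix `near` removes three ones: the corner and
-- one on each side of it. The `+ 2` on the left avoids truncated subtraction.
∑-width : ∀ n → ∑[ i < suc n ] width i + 2 ≡ 3 * suc n
∑-width zero    = refl
∑-width (suc n) = begin
  suc (first-row) + ∑[ i < suc n ] (nearℕ (suc (toℕ i)) 0 + width i) + 2
    ≡⟨ cong₂ (λ x y → suc x + y + 2) first-row≡1
         (∑-distrib-+ {suc n} (λ i → nearℕ (suc (toℕ i)) 0) width) ⟩
  2 + (first-column + ∑[ i < suc n ] width i) + 2
    ≡⟨ cong (λ x → 2 + (x + ∑[ i < suc n ] width i) + 2) first-column≡1 ⟩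
  3 + (∑[ i < suc n ] width i + 2)
    ≡⟨ cong (3 +_) (∑-width n) ⟩
  3 + 3 * suc n
    ≡⟨ sym (*-suc 3 (suc n)) ⟩
  3 * suc (suc n) ∎
  where
  open ≡-Reasoning
  first-row = ∑[ k < suc n ] nearℕ 0 (suc (toℕ k))
  first-column = ∑[ i < suc n ] nearℕ (suc (toℕ i)) 0
  first-row≡1 : first-row ≡ 1
  first-row≡1 = cong suc (sum-zero {n} (λ _ → refl))
  first-column≡1 : first-column ≡ 1
  first-column≡1 = cong suc (sum-zero {n} (λ _ → refl))

-- The number of ends of the line that `i` touches. A line of a single square touches both, so the
-- total is 2 for every positive length.
edge : Fin n → ℕ
edge i = 3 ∸ width i

∑-edge : ∀ n → ∑[ i < suc n ] edge i ≡ 2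
∑-edge n = +-cancelˡ-≡ (∑[ i < suc n ] width i) _ _ (begin
  ∑[ i < suc n ] width i + ∑[ i < suc n ] edge i
    ≡⟨ sym (∑-distrib-+ {suc n} width edge) ⟩
  ∑[ i < suc n ] (width i + edge i)
    ≡⟨ sum-cong-≗ {suc n} (λ i → m+[n∸m]≡n (width≤3 i)) ⟩
  ∑[ i < suc n ] 3
    ≡⟨ trans (sum-const (suc n) 3) (*-comm (suc n) 3) ⟩
  3 * suc n
    ≡⟨ sym (∑-width n) ⟩
  ∑[ i < suc n ] width i + 2 ∎)
  where open ≡-Reasoning

-- Guards with eight prisoner neighbours and the transfer two columns to the right.

-- The numbers of guards and prisoners at the middle square of a column of three
-- and in the whole column.
data Column : (g p G P : ℕ) → Set where
  off-board       : Column 0 0 0 0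
  prisoner-middle : ∀ {G P} → 1 ℕ.≤ P → P + G ℕ.≤ 3 → Column 0 1 G P
  guard-middle    : ∀ {G P} → 1 ℕ.≤ G → P + G ℕ.≤ 3 → Column 1 0 G P

column≤3 : ∀ {g p G P} → Column g p G P → P ℕ.≤ 3
column≤3 off-board             = z≤n
column≤3 (prisoner-middle _ q) = m+n≤o⇒m≤o _ q
column≤3 (guard-middle _ q)    = m+n≤o⇒m≤o _ q

own-surplus : ∀ g x → g * x ℕ.≤ 7 * g + g * (x ∸ 7)
own-surplus g x = begin
  g * x               ≤⟨ *-monoʳ-≤ g (m≤n+m∸n x 7) ⟩
  g * (7 + (x ∸ 7))   ≡⟨ *-distribˡ-+ g 7 (x ∸ 7) ⟩
  g * 7 + g * (x ∸ 7) ≡⟨ cong (_+ g * (x ∸ 7)) (*-comm g 7) ⟩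
  7 * g + g * (x ∸ 7) ∎
  where open ≤-Reasoning

no-surplus : ∀ g {s} x → s ≡ 0 → g * x + s ℕ.≤ 7 * g + g * (x ∸ 7)
no-surplus g x refl = ≤-trans (≤-reflexive (+-identityʳ (g * x))) (own-surplus g x)

-- Columns 0, …, 4, where column 1 may have in its middle a guard with surplus.
transfer : ∀ {P₀ g₁ p₁ G₁ P₁ g₂ p₂ G₂ P₂ g₃ p₃ G₃ P₃ P₄} →
  P₀ ℕ.≤ 3 → Column g₁ p₁ G₁ P₁ → Column g₂ p₂ G₂ P₂ → Column g₃ p₃ G₃ P₃ → P₄ ℕ.≤ 3 →
  (p₂ ≡ 1 → P₁ + P₂ + P₃ ℕ.≤ 1 + (G₁ + G₂ + G₃)) →
  g₃ * (P₂ + P₃ + P₄) + g₁ * (P₀ + P₁ + P₂ ∸ 7) ℕ.≤ 7 * g₃ + g₃ * (P₂ + P₃ + P₄ ∸ 7)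
transfer {g₃ = g} _ off-board _ _ _ _ = no-surplus g _ refl
transfer {g₃ = g} _ (prisoner-middle _ _) _ _ _ _ = no-surplus g _ refl
transfer {P₀} {P₁ = P₁} {P₂ = P₂} {g₃ = g} {P₄ = P₄} P₀≤3 (guard-middle 1≤G₁ q₁) c₂ c₃ P₄≤3 valid
  -- As `P₀ ≤ 3`, a sum of at most 4 leaves no excess over 7. Otherwise the sum is at least 5; the
  -- guard in column 1 allows only two prisoners there, so `P₁` is 2 and column 2 is full of
  -- prisoners.
  with P₁ + P₂ ℕ.≤? 4
... | yes few = no-surplus g _
  (trans (*-identityˡ _) (m≤n⇒m∸n≡0 (≤-trans (≤-reflexive (+-assoc P₀ P₁ P₂)) (+-mono-≤ P₀≤3 few))))
... | no many = absorbed P₁≡2 P₂≡3 q₁ c₂ c₃ valid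
  where
  5≤P₁+P₂ : 5 ℕ.≤ P₁ + P₂
  5≤P₁+P₂ = ≰⇒> many
  P₁≤2 : P₁ ℕ.≤ 2
  P₁≤2 = +-cancelʳ-≤ 1 P₁ 2 (≤-trans (+-monoʳ-≤ P₁ 1≤G₁) q₁)
  P₁≡2 : P₁ ≡ 2
  P₁≡2 = ≤-antisym P₁≤2 (+-cancelʳ-≤ 3 2 P₁ (≤-trans 5≤P₁+P₂ (+-monoʳ-≤ P₁ (column≤3 c₂))))
  P₂≡3 : P₂ ≡ 3
  P₂≡3 = ≤-antisym (column≤3 c₂) (+-cancelˡ-≤ 2 3 P₂ (≤-trans 5≤P₁+P₂ (+-monoˡ-≤ P₂ P₁≤2)))

  absorbed : ∀ {G₁ P₁ g₂ p₂ G₂ P₂ g₃ p₃ G₃ P₃} → P₁ ≡ 2 → P₂ ≡ 3 → P₁ + G₁ ℕ.≤ 3 →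
    Column g₂ p₂ G₂ P₂ → Column g₃ p₃ G₃ P₃ →
    (p₂ ≡ 1 → P₁ + P₂ + P₃ ℕ.≤ 1 + (G₁ + G₂ + G₃)) →
    g₃ * (P₂ + P₃ + P₄) + 1 * (P₀ + P₁ + P₂ ∸ 7) ℕ.≤ 7 * g₃ + g₃ * (P₂ + P₃ + P₄ ∸ 7)
  absorbed refl refl _ (guard-middle 1≤G₂ q₂) _ _ =
    contradiction (≤-trans 1≤G₂ (+-cancelˡ-≤ 3 _ 0 q₂)) λ ()
  absorbed {G₁} {G₂ = G₂} {G₃ = G₃} {P₃} refl refl q₁ (prisoner-middle _ q₂) c₃ valid =
    third-column P₃≡0 3≤G₃ c₃
    where
    open ≤-Reasoning
    -- Validity at the middle of column 2, where `G₁ ≤ 1` and `G₂ ≤ 0`, leaves column 3 to supply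
    -- the missing guards; having three squares, it must consist of guards only.
    3+P₃≤G₃ : 3 + P₃ ℕ.≤ G₃
    3+P₃≤G₃ = +-cancelˡ-≤ 2 (3 + P₃) G₃ (begin
      5 + P₃             ≤⟨ valid refl ⟩
      1 + (G₁ + G₂ + G₃) ≤⟨ +-monoʳ-≤ 1 (+-monoˡ-≤ G₃
                              (+-mono-≤ (+-cancelˡ-≤ 2 G₁ 1 q₁) (+-cancelˡ-≤ 3 G₂ 0 q₂))) ⟩
      2 + G₃             ∎)
    G₃≤3 : ∀ {g p G P} → Column g p G P → G ℕ.≤ 3
    G₃≤3 off-board             = z≤n
    G₃≤3 (prisoner-middle _ q) = m+n≤o⇒n≤o _ q
    G₃≤3 (guard-middle _ q)    = m+n≤o⇒n≤o _ q
    P₃≡0 : P₃ ≡ 0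
    P₃≡0 = n≤0⇒n≡0 (+-cancelˡ-≤ 3 P₃ 0 (≤-trans 3+P₃≤G₃ (G₃≤3 c₃)))
    3≤G₃ : 3 ℕ.≤ G₃
    3≤G₃ = m+n≤o⇒m≤o 3 3+P₃≤G₃

    third-column : ∀ {g p G P} → P ≡ 0 → 3 ℕ.≤ G → Column g p G P →
      g * (3 + P + P₄) + 1 * (P₀ + 2 + 3 ∸ 7) ℕ.≤ 7 * g + g * (3 + P + P₄ ∸ 7)
    -- Three guards need a column on the board, so no surplus is sent over the right edge.
    third-column _    () off-board
    third-column refl _  (prisoner-middle () _)
    -- The absorbing guard sees at most `3 + 0 + 3`, that is 6, prisoners, and the incoming surplus
    -- is at most `3 + 2 + 3 ∸ 7`, that is 1.
    third-column refl _  (guard-middle _ _) = begin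
      1 * (3 + 0 + P₄) + 1 * (P₀ + 2 + 3 ∸ 7)
        ≤⟨ +-mono-≤ (*-monoʳ-≤ 1 (+-monoʳ-≤ 3 P₄≤3))
                    (*-monoʳ-≤ 1 (∸-monoˡ-≤ 7 (+-monoˡ-≤ 3 (+-monoˡ-≤ 2 P₀≤3)))) ⟩
      7
        ≤⟨ m≤m+n 7 _ ⟩
      7 * 1 + 1 * (3 + 0 + P₄ ∸ 7) ∎

-- Summing the transfers along a row.

-- Here `s k` is what position `k` absorbs and `s (2 + k)` what it passes on. The two cancel in the
-- sum except for two terms at each end, because transfers skip one position.
telescope : (a b s : ℕ → ℕ) → (∀ k → a k + s k ℕ.≤ b k + s (2 + k)) →
  ∀ m → ∑[ k < m ] a (toℕ k) + (s 0 + s 1) ℕ.≤ ∑[ k < m ] b (toℕ k) + (s m + s (1 + m))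
telescope a b s step zero    = ≤-refl
telescope a b s step (suc m) = begin
  a 0 + Σa + (s 0 + s 1)
    ≡⟨ regroup (a 0) Σa (s 0) (s 1) ⟩
  (a 0 + s 0) + (Σa + s 1)
    ≤⟨ +-monoˡ-≤ (Σa + s 1) (step 0) ⟩
  (b 0 + s 2) + (Σa + s 1)
    ≡⟨ regroup′ (b 0) (s 2) Σa (s 1) ⟩
  b 0 + (Σa + (s 1 + s 2))
    ≤⟨ +-monoʳ-≤ (b 0) (telescope (a ∘ suc) (b ∘ suc) (s ∘ suc) (step ∘ suc) m) ⟩
  b 0 + (Σb + (s (1 + m) + s (2 + m)))
    ≡⟨ sym (+-assoc (b 0) Σb _) ⟩
  b 0 + Σb + (s (1 + m) + s (2 + m)) ∎
  where
  open ≤-Reasoning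
  Σa = ∑[ k < m ] a (suc (toℕ k))
  Σb = ∑[ k < m ] b (suc (toℕ k))
  regroup : ∀ w x y z → w + x + (y + z) ≡ (w + y) + (x + z)
  regroup = solve-∀
  regroup′ : ∀ w x y z → (w + x) + (y + z) ≡ w + (y + (z + x))
  regroup′ = solve-∀

-- A row of the board with the two adjacent rows, as sequences of columns.
module Row {n} (g p G P : Fin n → ℕ) (columns : ∀ j → Column (g j) (p j) (G j) (P j))
  (valid : ∀ j → p j ≡ 1 → triple (pad P) (toℕ j) ℕ.≤ 1 + triple (pad G) (toℕ j)) where

  extended-column : ∀ {m} (g p G P : Fin m → ℕ) → (∀ j → Column (g j) (p j) (G j) (P j)) →
    ∀ k → Column (extend g k) (extend p k) (extend G k) (extend P k)
  extended-column {zero}  _ _ _ _ cs k       = off-board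
  extended-column {suc m} _ _ _ _ cs zero    = cs zero
  extended-column {suc m} _ _ _ _ cs (suc k) = extended-column _ _ _ _ (cs ∘ suc) k

  column : ∀ k → Column (extend g k) (extend p k) (extend G k) (extend P k)
  column = extended-column g p G P columns

  -- Off the board `extend p` is 0, so the premise fails and only genuine columns have to be
  -- checked.
  extended-valid : ∀ k → extend p k ≡ 1 → triple (pad P) k ℕ.≤ 1 + triple (pad G) k
  extended-valid = extend-property p (λ k x → x ≡ 1 → triple (pad P) k ℕ.≤ 1 + triple (pad G) k)
    valid (λ _ ())
    where
    extend-property : ∀ {m} (f : Fin m → ℕ) (Q : ℕ → ℕ → Set) →
      (∀ j → Q (toℕ j) (f j)) → (∀ k → Q k 0) → ∀ k → Q k (extend f k)
    extend-property {zero}  f Q q q₀ k       = q₀ k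
    extend-property {suc m} f Q q q₀ zero    = q zero
    extend-property {suc m} f Q q q₀ (suc k) =
      extend-property (f ∘ suc) (Q ∘ suc) (q ∘ suc) (q₀ ∘ suc) k

  pad-P≤3 : ∀ k → pad P k ℕ.≤ 3
  pad-P≤3 zero    = z≤n
  pad-P≤3 (suc k) = column≤3 (column k)

  -- The excess over 7 at column k - 2, which column k absorbs.
  surplus : ℕ → ℕ
  surplus zero          = 0
  surplus (suc zero)    = 0
  surplus (suc (suc k)) = extend g k * (triple (pad P) k ∸ 7)

  pairs : ℕ → ℕ
  pairs k = extend g k * triple (pad P) k

  step : ∀ k → pairs k + surplus k ℕ.≤ 7 * extend g k + surplus (2 + k)
  step zero          = no-surplus (extend g 0) _ refl
  step (suc zero)    = no-surplus (extend g 1) _ refl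
  -- By the shift in `pad`, index `k` is the column left of `column k` and index `4 + k` the one
  -- right of `column (2 + k)`. Validity enters at the middle column `1 + k`.
  step (suc (suc k)) = transfer (pad-P≤3 k) (column k) (column (1 + k)) (column (2 + k))
    (pad-P≤3 (4 + k)) (extended-valid (1 + k))

  row-bound : ∑[ j < n ] (g j * triple (pad P) (toℕ j)) ℕ.≤ 7 * sum g
  row-bound = begin
    ∑[ j < n ] (g j * triple (pad P) (toℕ j))
      ≡⟨ sum-cong-≗ (λ j → cong (_* triple (pad P) (toℕ j)) (sym (extend-toℕ g j))) ⟩
    ∑[ j < n ] pairs (toℕ j)
      -- Two extra columns make the telescoped remainder vanish: `surplus (n + 2)` and
      -- `surplus (1 + (n + 2))` refer to guards in columns `n` and `1 + n`, which are off the
      -- board.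
      ≡⟨ sym (∑-truncate n {2} pairs λ k → cong (_* triple (pad P) (n + k)) (extend-beyond n g k)) ⟩
    ∑[ j < n + 2 ] pairs (toℕ j)
      ≤⟨ m≤m+n _ _ ⟩
    ∑[ j < n + 2 ] pairs (toℕ j) + (surplus 0 + surplus 1)
      ≤⟨ telescope pairs (λ k → 7 * extend g k) surplus step (n + 2) ⟩
    ∑[ j < n + 2 ] (7 * extend g (toℕ j)) + (surplus (n + 2) + surplus (1 + (n + 2)))
      ≡⟨ cong₂ _+_ (∑-truncate n {2} (λ k → 7 * extend g k) λ k → cong (7 *_) (extend-beyond n g k))
           (cong₂ _+_ (no-surplus-beyond 0) (no-surplus-beyond 1)) ⟩
    ∑[ j < n ] (7 * extend g (toℕ j)) + 0
      ≡⟨ +-identityʳ _ ⟩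
    ∑[ j < n ] (7 * extend g (toℕ j))
      ≡⟨ sum-cong-≗ (λ j → cong (7 *_) (extend-toℕ g j)) ⟩
    ∑[ j < n ] (7 * g j)
      ≡⟨ sym (*-distribˡ-sum 7 g) ⟩
    7 * sum g ∎
    where
    open ≤-Reasoning
    no-surplus-beyond : ∀ k → surplus (k + (n + 2)) ≡ 0
    no-surplus-beyond k = begin-equality
      surplus (k + (n + 2))
        ≡⟨ cong surplus (rearranged k n) ⟩
      surplus (2 + (n + k))
        ≡⟨ cong (_* (triple (pad P) (n + k) ∸ 7)) (extend-beyond n g k) ⟩
      0 ∎
      where
      rearranged : ∀ k n → k + (n + 2) ≡ 2 + (n + k)
      rearranged = solve-∀

-- Block sums and double counting.

around : (Fin n → ℕ) → Fin n → ℕ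
around {n} f i = ∑[ k < n ] (near i k * f k)

-- The centre is included; iterating line sums lets each direction be treated on its own.
block : (Fin n → Fin n → ℕ) → Fin n → Fin n → ℕ
block f i j = around (λ k → around (f k) j) i

around-cong : {f h : Fin n → ℕ} → (∀ k → f k ≡ h k) → ∀ i → around f i ≡ around h i
around-cong f≡h i = sum-cong-≗ (λ k → cong (near i k *_) (f≡h k))

around-+ : (f h : Fin n → ℕ) → ∀ i → around f i + around h i ≡ around (λ k → f k + h k) i
around-+ f h i = trans
  (sym (∑-distrib-+ (λ k → near i k * f k) (λ k → near i k * h k)))
  (sum-cong-≗ (λ k → sym (*-distribˡ-+ (near i k) (f k) (h k))))

around-const : ∀ x (i : Fin n) → around (λ _ → x) i ≡ width i * x
around-const x i = sym (*-distribʳ-sum x (near i))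

≤around : (f : Fin n → ℕ) → ∀ i → f i ℕ.≤ around f i
≤around f i = begin
  f i            ≡⟨ sym (trans (cong (_* f i) (near-refl i)) (*-identityˡ (f i))) ⟩
  near i i * f i ≤⟨ term≤sum (λ k → near i k * f k) i ⟩
  around f i     ∎
  where open ≤-Reasoning

-- A symmetric kernel is self-adjoint: exchange the sums and apply `near-sym`.
around-adjoint : (f h : Fin n → ℕ) →
  ∑[ i < n ] (f i * around h i) ≡ ∑[ i < n ] (around f i * h i)
around-adjoint {n} f h = begin
  ∑[ i < n ] (f i * around h i)
    ≡⟨ sum-cong-≗ (λ i → *-distribˡ-sum (f i) (λ k → near i k * h k)) ⟩
  ∑[ i < n ] ∑[ k < n ] (f i * (near i k * h k))
    ≡⟨ ∑-comm (λ i k → f i * (near i k * h k)) ⟩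
  ∑[ k < n ] ∑[ i < n ] (f i * (near i k * h k))
    ≡⟨ sum-cong-≗ (λ k → sum-cong-≗ (λ i → swapped i k)) ⟩
  ∑[ k < n ] ∑[ i < n ] (near k i * f i * h k)
    ≡⟨ sum-cong-≗ (λ k → sym (*-distribʳ-sum (h k) (λ i → near k i * f i))) ⟩
  ∑[ k < n ] (around f k * h k) ∎
  where
  open ≡-Reasoning
  rearranged : ∀ x y z → x * (y * z) ≡ y * x * z
  rearranged = solve-∀
  swapped : ∀ i k → f i * (near i k * h k) ≡ near k i * f i * h k
  swapped i k = trans (rearranged (f i) (near i k) (h k))
                      (cong (λ x → x * f i * h k) (near-sym i k))

-- Summing vertically first turns a row and its two neighbours into the single sequence of columns
-- on which `Row` works.
block-columns : (f : Fin n → Fin n → ℕ) → ∀ i j →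
  block f i j ≡ around (λ l → around (λ k → f k l) i) j
block-columns {n} f i j = begin
  ∑[ k < n ] (near i k * around (f k) j)
    ≡⟨ sum-cong-≗ (λ k → *-distribˡ-sum (near i k) (λ l → near j l * f k l)) ⟩
  ∑[ k < n ] ∑[ l < n ] (near i k * (near j l * f k l))
    ≡⟨ ∑-comm (λ k l → near i k * (near j l * f k l)) ⟩
  ∑[ l < n ] ∑[ k < n ] (near i k * (near j l * f k l))
    ≡⟨ sum-cong-≗ (λ l → sum-cong-≗ (λ k → rearranged (near i k) (near j l) (f k l))) ⟩
  ∑[ l < n ] ∑[ k < n ] (near j l * (near i k * f k l))
    ≡⟨ sum-cong-≗ (λ l → sym (*-distribˡ-sum (near j l) (λ k → near i k * f k l))) ⟩
  ∑[ l < n ] (near j l * around (λ k → f k l) i) ∎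
  where
  open ≡-Reasoning
  rearranged : ∀ x y z → x * (y * z) ≡ y * (x * z)
  rearranged = solve-∀

-- One-dimensional adjointness, applied once vertically and once horizontally.
block-adjoint : (f h : Fin n → Fin n → ℕ) →
  ∑[ i < n ] ∑[ j < n ] (f i j * block h i j) ≡ ∑[ i < n ] ∑[ j < n ] (block f i j * h i j)
block-adjoint {n} f h = begin
  ∑[ i < n ] ∑[ j < n ] (f i j * block h i j)
    ≡⟨ ∑-comm (λ i j → f i j * block h i j) ⟩
  ∑[ j < n ] ∑[ i < n ] (f i j * block h i j)
    ≡⟨ sum-cong-≗ (λ j → around-adjoint (λ k → f k j) (λ k → around (h k) j)) ⟩
  ∑[ j < n ] ∑[ i < n ] (around (λ k → f k j) i * around (h i) j)
    ≡⟨ ∑-comm (λ j i → around (λ k → f k j) i * around (h i) j) ⟩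
  ∑[ i < n ] ∑[ j < n ] (around (λ k → f k j) i * around (h i) j)
    ≡⟨ sum-cong-≗ (λ i → around-adjoint (λ l → around (λ k → f k l) i) (h i)) ⟩
  ∑[ i < n ] ∑[ j < n ] (around (λ l → around (λ k → f k l) i) j * h i j)
    ≡⟨ sum-cong-≗ (λ i → sum-cong-≗ (λ j → cong (_* h i j) (sym (block-columns f i j)))) ⟩
  ∑[ i < n ] ∑[ j < n ] (block f i j * h i j) ∎
  where open ≡-Reasoning

-- Neighbour counts compared with block sums.

∑-equal : (i : Fin n) → ∑[ k < n ] ⟦ i ≟ᶠ k ⟧ ≡ 1
∑-equal {suc n} zero    = cong suc (sum-zero {n} (λ _ → refl))
∑-equal         (suc i) = ∑-equal i

-- The decisions are arbitrary, so that the proof is a split into `yes` and `no`; `a?` stands for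
-- equality of the two squares.
adjacent≤near : {a q r z : Set} (a? : Dec a) (q? : Dec q) (r? : Dec r) (z? : Dec z) →
  ⟦ (¬? a? ×-dec q? ×-dec r?) ×-dec z? ⟧ ℕ.≤ ⟦ q? ⟧ * (⟦ r? ⟧ * ⟦ z? ⟧)
adjacent≤near (yes _) _       _       _       = z≤n
adjacent≤near (no _)  (no _)  _       _       = z≤n
adjacent≤near (no _)  (yes _) (no _)  _       = z≤n
adjacent≤near (no _)  (yes _) (yes _) (no _)  = z≤n
adjacent≤near (no _)  (yes _) (yes _) (yes _) = ≤-refl

-- The centre is the one near square that is not adjacent, and `⟦ a? ⟧` pays for it.
near≤adjacent : {a q r z : Set} (a? : Dec a) (q? : Dec q) (r? : Dec r) (z? : Dec z) →
  ⟦ q? ⟧ * (⟦ r? ⟧ * ⟦ z? ⟧) ℕ.≤ ⟦ a? ⟧ + ⟦ (¬? a? ×-dec q? ×-dec r?) ×-dec z? ⟧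
near≤adjacent a?      (no _)  _       _       = z≤n
near≤adjacent a?      (yes _) (no _)  _       = z≤n
near≤adjacent a?      (yes _) (yes _) (no _)  = z≤n
near≤adjacent (yes _) (yes _) (yes _) (yes _) = s≤s z≤n
near≤adjacent (no _)  (yes _) (yes _) (yes _) = s≤s z≤n

equal-square : ∀ (i j k l : Fin n) → ⟦ (i , j) ≟ˢ (k , l) ⟧ ≡ ⟦ i ≟ᶠ k ⟧ * ⟦ j ≟ᶠ l ⟧
equal-square i j k l with i ≟ᶠ k
... | no _     = refl
... | yes refl = sym (*-identityˡ ⟦ j ≟ᶠ l ⟧)

-- `B` and `b` count the prisoners and guards of a `w` by `v` block around a prisoner. Their balance
-- gives `w * v ≤ 1 + 2 * b`, and each missing side is compensated by the 2 in front of the edge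
-- terms.
prisoner-deficit : ∀ w v B b → 2 ℕ.≤ w → w ℕ.≤ 3 → 2 ℕ.≤ v → v ℕ.≤ 3 →
  B + b ≡ w * v → B ℕ.≤ 1 + b → 4 ℕ.≤ b + ((3 ∸ w) + (3 ∸ v))
prisoner-deficit w v B b 2≤w w≤3 2≤v v≤3 total B≤1+b =
  -- Twice the right-hand side is at least 7, hence exceeds 6; integrality rounds the half up to 4.
  *-cancelˡ-< 2 3 (b + ((3 ∸ w) + (3 ∸ v))) (s≤s⁻¹ (begin
    8
      ≤⟨ corner 2≤w w≤3 2≤v v≤3 ⟩
    w * v + 2 * ((3 ∸ w) + (3 ∸ v))
      ≡⟨ cong (_+ 2 * ((3 ∸ w) + (3 ∸ v))) (sym total) ⟩
    B + b + 2 * ((3 ∸ w) + (3 ∸ v))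
      ≤⟨ +-monoˡ-≤ _ (+-monoˡ-≤ b B≤1+b) ⟩
    1 + b + b + 2 * ((3 ∸ w) + (3 ∸ v))
      ≡⟨ doubled b ((3 ∸ w) + (3 ∸ v)) ⟩
    1 + 2 * (b + ((3 ∸ w) + (3 ∸ v))) ∎))
  where
  open ≤-Reasoning
  doubled : ∀ b e → 1 + b + b + 2 * e ≡ 1 + 2 * (b + e)
  doubled = solve-∀
  two-or-three : ∀ {x} → 2 ℕ.≤ x → x ℕ.≤ 3 → x ≡ 2 ⊎ x ≡ 3
  two-or-three (s≤s (s≤s z≤n)) (s≤s (s≤s z≤n))       = inj₁ refl
  two-or-three (s≤s (s≤s z≤n)) (s≤s (s≤s (s≤s z≤n))) = inj₂ refl
  corner : ∀ {w v} → 2 ℕ.≤ w → w ℕ.≤ 3 → 2 ℕ.≤ v → v ℕ.≤ 3 →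
    8 ℕ.≤ w * v + 2 * ((3 ∸ w) + (3 ∸ v))
  corner a b c d with two-or-three a b | two-or-three c d
  ... | inj₁ refl | inj₁ refl = m≤m+n 8 _
  ... | inj₁ refl | inj₂ refl = m≤m+n 8 _
  ... | inj₂ refl | inj₁ refl = m≤m+n 8 _
  ... | inj₂ refl | inj₂ refl = m≤m+n 8 _

-- The two bounds on the prisoner-guard pairs of a valid board.

module Board {m} (c : Configuration (2 + m)) (c-valid : Valid c) where

  private
    N = 2 + m

  indicator : Occupant → Fin N → Fin N → ℕ
  indicator o i j = ⟦ occupant c (i , j) ≟ᵒ o ⟧

  p g : Fin N → Fin N → ℕ
  p = indicator prisoner
  g = indicator guard

  p+g≡1 : ∀ i j → p i j + g i j ≡ 1
  p+g≡1 i j with occupant c (i , j)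
  ... | prisoner = refl
  ... | guard    = refl

  block-expanded : ∀ f i j →
    block f i j ≡ ∑[ k < N ] ∑[ l < N ] (near i k * (near j l * f k l))
  block-expanded f i j = sum-cong-≗ (λ k → *-distribˡ-sum (near i k) (λ l → near j l * f k l))

  neighbours≡∑ : ∀ i j o → neighbours c (i , j) o ≡
    ∑[ k < N ] ∑[ l < N ] ⟦ adjacent? (i , j) (k , l) ×-dec occupant c (k , l) ≟ᵒ o ⟧
  neighbours≡∑ i j o = count-squares (λ t → adjacent? (i , j) t ×-dec occupant c t ≟ᵒ o)

  neighbours≤block : ∀ i j o → neighbours c (i , j) o ℕ.≤ block (indicator o) i j
  neighbours≤block i j o = begin
    neighbours c (i , j) o
      ≡⟨ neighbours≡∑ i j o ⟩
    ∑[ k < N ] ∑[ l < N ] ⟦ adjacent? (i , j) (k , l) ×-dec occupant c (k , l) ≟ᵒ o ⟧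
      ≤⟨ sum-mono (λ k → sum-mono (λ l → adjacent≤near ((i , j) ≟ˢ (k , l))
           (∣ toℕ i - toℕ k ∣ ≤? 1) (∣ toℕ j - toℕ l ∣ ≤? 1) (occupant c (k , l) ≟ᵒ o))) ⟩
    ∑[ k < N ] ∑[ l < N ] (near i k * (near j l * indicator o k l))
      ≡⟨ sym (block-expanded (indicator o) i j) ⟩
    block (indicator o) i j ∎
    where open ≤-Reasoning

  block≤neighbours : ∀ i j o → block (indicator o) i j ℕ.≤ 1 + neighbours c (i , j) o
  block≤neighbours i j o = begin
    block (indicator o) i j
      ≡⟨ block-expanded (indicator o) i j ⟩
    ∑[ k < N ] ∑[ l < N ] (near i k * (near j l * indicator o k l))
      ≤⟨ sum-mono (λ k → sum-mono (λ l → near≤adjacent ((i , j) ≟ˢ (k , l))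
           (∣ toℕ i - toℕ k ∣ ≤? 1) (∣ toℕ j - toℕ l ∣ ≤? 1) (occupant c (k , l) ≟ᵒ o))) ⟩
    ∑[ k < N ] ∑[ l < N ] (equal k l + adjacent k l)
      ≡⟨ sum-cong-≗ (λ k → ∑-distrib-+ (equal k) (adjacent k)) ⟩
    ∑[ k < N ] (sum (equal k) + sum (adjacent k))
      ≡⟨ ∑-distrib-+ (λ k → sum (equal k)) (λ k → sum (adjacent k)) ⟩
    ∑[ k < N ] sum (equal k) + ∑[ k < N ] sum (adjacent k)
      ≡⟨ cong₂ _+_ ∑∑-equal (sym (neighbours≡∑ i j o)) ⟩
    1 + neighbours c (i , j) o ∎
    where
    open ≤-Reasoning
    equal adjacent : Fin N → Fin N → ℕ
    equal k l = ⟦ (i , j) ≟ˢ (k , l) ⟧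
    adjacent k l = ⟦ adjacent? (i , j) (k , l) ×-dec occupant c (k , l) ≟ᵒ o ⟧
    ∑∑-equal : ∑[ k < N ] sum (equal k) ≡ 1
    ∑∑-equal = begin-equality
      ∑[ k < N ] sum (equal k)
        ≡⟨ sum-cong-≗ (λ k → sum-cong-≗ (λ l → equal-square i j k l)) ⟩
      ∑[ k < N ] ∑[ l < N ] (⟦ i ≟ᶠ k ⟧ * ⟦ j ≟ᶠ l ⟧)
        ≡⟨ sum-cong-≗ (λ k → sym (*-distribˡ-sum ⟦ i ≟ᶠ k ⟧ (λ l → ⟦ j ≟ᶠ l ⟧))) ⟩
      ∑[ k < N ] (⟦ i ≟ᶠ k ⟧ * ∑[ l < N ] ⟦ j ≟ᶠ l ⟧)
        ≡⟨ sum-cong-≗ (λ k → trans (cong (⟦ i ≟ᶠ k ⟧ *_) (∑-equal j)) (*-identityʳ ⟦ i ≟ᶠ k ⟧)) ⟩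
      ∑[ k < N ] ⟦ i ≟ᶠ k ⟧
        ≡⟨ ∑-equal i ⟩
      1 ∎

  -- The added 1 is the prisoner at the centre, which the block counts and `neighbours` does not.
  block-valid : ∀ i j → p i j ≡ 1 → block p i j ℕ.≤ 1 + block g i j
  block-valid i j p≡1 = begin
    block p i j                         ≤⟨ block≤neighbours i j prisoner ⟩
    1 + neighbours c (i , j) prisoner   ≤⟨ +-monoʳ-≤ 1 (c-valid (i , j) (occupied p≡1)) ⟩
    1 + neighbours c (i , j) guard      ≤⟨ +-monoʳ-≤ 1 (neighbours≤block i j guard) ⟩
    1 + block g i j                     ∎
    where
    open ≤-Reasoning
    occupied : p i j ≡ 1 → occupant c (i , j) ≡ prisoner
    occupied eq with occupant c (i , j)
    ... | prisoner = refl

  around-p+g : ∀ (i j : Fin N) → around (λ k → p k j) i + around (λ k → g k j) i ≡ width i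
  around-p+g i j = begin
    around (λ k → p k j) i + around (λ k → g k j) i ≡⟨ around-+ (λ k → p k j) (λ k → g k j) i ⟩
    around (λ k → p k j + g k j) i                  ≡⟨ around-cong (λ k → p+g≡1 k j) i ⟩
    around (λ _ → 1) i                              ≡⟨ around-const 1 i ⟩
    width i * 1                                     ≡⟨ *-identityʳ (width i) ⟩
    width i                                         ∎
    where open ≡-Reasoning

  block-p+g : ∀ i j → block p i j + block g i j ≡ width i * width j
  block-p+g i j = begin
    block p i j + block g i j
      ≡⟨ cong₂ _+_ (block-columns p i j) (block-columns g i j) ⟩
    around (λ l → around (λ k → p k l) i) j + around (λ l → around (λ k → g k l) i) j
      ≡⟨ around-+ (λ l → around (λ k → p k l) i) (λ l → around (λ k → g k l) i) j ⟩
    around (λ l → around (λ k → p k l) i + around (λ k → g k l) i) j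
      ≡⟨ around-cong (around-p+g i) j ⟩
    around (λ _ → width i) j
      ≡⟨ around-const (width i) j ⟩
    width j * width i
      ≡⟨ *-comm (width j) (width i) ⟩
    width i * width j ∎
    where open ≡-Reasoning

  column : ∀ i j → Column (g i j) (p i j) (around (λ k → g k j) i) (around (λ k → p k j) i)
  column i j = classify (p+g≡1 i j) (≤around (λ k → g k j) i) (≤around (λ k → p k j) i)
    (≤-trans (≤-reflexive (around-p+g i j)) (width≤3 i))
    where
    classify : ∀ {g p G P} → p + g ≡ 1 → g ℕ.≤ G → p ℕ.≤ P → P + G ℕ.≤ 3 → Column g p G P
    classify {p = 0}           refl g≤G _   q = guard-middle g≤G q
    classify {zero}  {p = suc zero} refl _   p≤P q = prisoner-middle p≤P q

  block≡triple : ∀ (f : Fin N → Fin N → ℕ) i j →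
    block f i j ≡ triple (pad (λ l → around (λ k → f k l) i)) (toℕ j)
  block≡triple f i j = trans (block-columns f i j) (near-sum (λ l → around (λ k → f k l) i) j)

  row-valid : ∀ i j → p i j ≡ 1 → triple (pad (λ l → around (λ k → p k l) i)) (toℕ j)
    ℕ.≤ 1 + triple (pad (λ l → around (λ k → g k l) i)) (toℕ j)
  row-valid i j p≡1 =
    subst₂ (λ x y → x ℕ.≤ 1 + y) (block≡triple p i j) (block≡triple g i j) (block-valid i j p≡1)

  ∑p ∑g : ℕ
  ∑p = ∑[ i < N ] ∑[ j < N ] p i j
  ∑g = ∑[ i < N ] ∑[ j < N ] g i j

  -- Transfers stay within a row, so the rows can be bounded independently.
  upper : ∑[ i < N ] ∑[ j < N ] (g i j * block p i j) ℕ.≤ 7 * ∑g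
  upper = begin
    ∑[ i < N ] ∑[ j < N ] (g i j * block p i j)
      ≡⟨ sum-cong-≗ (λ i → sum-cong-≗ (λ j → cong (g i j *_) (block≡triple p i j))) ⟩
    ∑[ i < N ] ∑[ j < N ] (g i j * triple (pad (λ l → around (λ k → p k l) i)) (toℕ j))
      ≤⟨ sum-mono (λ i → Row.row-bound (g i) (p i) _ _ (column i) (row-valid i)) ⟩
    ∑[ i < N ] (7 * ∑[ j < N ] g i j)
      ≡⟨ sym (*-distribˡ-sum 7 (λ i → ∑[ j < N ] g i j)) ⟩
    7 * ∑g ∎
    where open ≤-Reasoning

  -- The edge terms are granted to guards as well, which makes their total depend on `N` alone.
  square-lower : ∀ i j → 4 * p i j ℕ.≤ p i j * block g i j + (edge i + edge j)
  square-lower i j = by-occupant (p i j) refl (p+g≡1 i j)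
    where
    by-occupant : ∀ x → p i j ≡ x → x + g i j ≡ 1 → 4 * x ℕ.≤ x * block g i j + (edge i + edge j)
    by-occupant zero       _   _ = z≤n
    by-occupant (suc zero) p≡1 _ = ≤-trans
      (prisoner-deficit (width i) (width j) (block p i j) (block g i j)
        (2≤width i) (width≤3 i) (2≤width j) (width≤3 j) (block-p+g i j) (block-valid i j p≡1))
      (≤-reflexive (cong (_+ (edge i + edge j)) (sym (*-identityˡ (block g i j)))))

  -- Each of the four sides touches `N` squares, a corner counting for two sides.
  ∑-edges : ∑[ i < N ] ∑[ j < N ] (edge i + edge j) ≡ 4 * N
  ∑-edges = begin
    ∑[ i < N ] ∑[ j < N ] (edge i + edge j)
      ≡⟨ sum-cong-≗ {N} (λ i → trans (∑-distrib-+ {N} (λ _ → edge i) edge)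
                                     (cong₂ _+_ (sum-const N (edge i)) (∑-edge (1 + m)))) ⟩
    ∑[ i < N ] (N * edge i + 2)
      ≡⟨ ∑-distrib-+ {N} (λ i → N * edge i) (λ _ → 2) ⟩
    ∑[ i < N ] (N * edge i) + ∑[ i < N ] 2
      ≡⟨ cong₂ _+_ (trans (sym (*-distribˡ-sum {N} N edge)) (cong (N *_) (∑-edge (1 + m))))
                   (sum-const N 2) ⟩
    N * 2 + N * 2
      ≡⟨ collected N ⟩
    4 * N ∎
    where
    open ≡-Reasoning
    collected : ∀ x → x * 2 + x * 2 ≡ 4 * x
    collected = solve-∀

  lower : 4 * ∑p ℕ.≤ ∑[ i < N ] ∑[ j < N ] (p i j * block g i j) + 4 * N
  lower = begin
    4 * ∑p
      ≡⟨ *-distribˡ-sum 4 (λ i → ∑[ j < N ] p i j) ⟩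
    ∑[ i < N ] (4 * ∑[ j < N ] p i j)
      ≡⟨ sum-cong-≗ (λ i → *-distribˡ-sum 4 (p i)) ⟩
    ∑[ i < N ] ∑[ j < N ] (4 * p i j)
      ≤⟨ sum-mono (λ i → sum-mono (square-lower i)) ⟩
    ∑[ i < N ] ∑[ j < N ] (p i j * block g i j + (edge i + edge j))
      ≡⟨ sum-cong-≗ (λ i → ∑-distrib-+ (λ j → p i j * block g i j) (λ j → edge i + edge j)) ⟩
    ∑[ i < N ] (∑[ j < N ] (p i j * block g i j) + ∑[ j < N ] (edge i + edge j))
      ≡⟨ ∑-distrib-+ (λ i → ∑[ j < N ] (p i j * block g i j)) (λ i → ∑[ j < N ] (edge i + edge j)) ⟩
    ∑[ i < N ] ∑[ j < N ] (p i j * block g i j) + ∑[ i < N ] ∑[ j < N ] (edge i + edge j)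
      ≡⟨ cong (∑[ i < N ] ∑[ j < N ] (p i j * block g i j) +_) ∑-edges ⟩
    ∑[ i < N ] ∑[ j < N ] (p i j * block g i j) + 4 * N ∎
    where open ≤-Reasoning

  ∑p+∑g : ∑p + ∑g ≡ N * N
  ∑p+∑g = begin
    ∑p + ∑g
      ≡⟨ sym (∑-distrib-+ (λ i → sum (p i)) (λ i → sum (g i))) ⟩
    ∑[ i < N ] (sum (p i) + sum (g i))
      ≡⟨ sum-cong-≗ (λ i → trans (sym (∑-distrib-+ (p i) (g i))) (sum-cong-≗ (p+g≡1 i))) ⟩
    ∑[ i < N ] ∑[ j < N ] 1
      ≡⟨ sum-cong-≗ {N} (λ _ → trans (sum-const N 1) (*-identityʳ N)) ⟩
    ∑[ i < N ] N
      ≡⟨ sum-const N N ⟩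
    N * N ∎
    where open ≡-Reasoning

  -- The same pairs are counted from the prisoners in `lower` and from the guards in `upper`.
  4∑p≤7∑g+4N : 4 * ∑p ℕ.≤ 7 * ∑g + 4 * N
  4∑p≤7∑g+4N = begin
    4 * ∑p
      ≤⟨ lower ⟩
    ∑[ i < N ] ∑[ j < N ] (p i j * block g i j) + 4 * N
      ≡⟨ cong (_+ 4 * N) (trans (block-adjoint p g)
           (sum-cong-≗ (λ i → sum-cong-≗ (λ j → *-comm (block p i j) (g i j))))) ⟩
    ∑[ i < N ] ∑[ j < N ] (g i j * block p i j) + 4 * N
      ≤⟨ +-monoˡ-≤ (4 * N) upper ⟩
    7 * ∑g + 4 * N ∎
    where open ≤-Reasoning

  prisoners-bound : prisoners c * 11 ℕ.≤ 7 * N ^ 2 + 4 * N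
  prisoners-bound = begin
    prisoners c * 11
      ≡⟨ cong (_* 11) (count-squares (λ s → occupant c s ≟ᵒ prisoner)) ⟩
    ∑p * 11
      -- Here 11 is split as 4 + 7, so that the second part completes `7 * ∑g` to seven times the
      -- whole board.
      ≡⟨ split ∑p ⟩
    4 * ∑p + 7 * ∑p
      ≤⟨ +-monoˡ-≤ (7 * ∑p) 4∑p≤7∑g+4N ⟩
    7 * ∑g + 4 * N + 7 * ∑p
      ≡⟨ collected ∑g N ∑p ⟩
    7 * (∑p + ∑g) + 4 * N
      ≡⟨ cong (λ x → 7 * x + 4 * N) (trans ∑p+∑g (cong (N *_) (sym (*-identityʳ N)))) ⟩
    7 * N ^ 2 + 4 * N ∎
    where
    open ≤-Reasoning
    split : ∀ x → x * 11 ≡ 4 * x + 7 * x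
    split = solve-∀
    collected : ∀ y z x → 7 * y + 4 * z + 7 * x ≡ 7 * (x + y) + 4 * z
    collected = solve-∀

-- The bound for a maximum configuration and its rational form.

P-bound : ∀ n → n ≥ 2 → P n * 11 ℕ.≤ 7 * n ^ 2 + 4 * n
P-bound (suc zero)    (s≤s ())
P-bound (suc (suc m)) _ =
  Board.prisoners-bound (proj₁ best) (proj₁ (proj₂ best))
  where best = maximumConfiguration (2 + m)

-- Opened here because the prefix +_ makes sections such as (x +_) ambiguous.
open import Data.Integer using (+_; +≤+)
open import Data.Integer.Properties using (pos-*)

theorem4p5 : ∀ (n : ℕ) → n ≥ 3 →
    (+ P n) / 1 ≤ (+ (7 * n ^ 2 + 4 * n)) / 11
-- Unnormalised fractions compare by cross-multiplication in the integers; `pos-*` takes the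
-- products back to naturals.
theorem4p5 n n≥3 = *≤* (subst₂ ℤ._≤_ (pos-* (P n) 11) (pos-* (7 * n ^ 2 + 4 * n) 1)
  (+≤+ (≤-trans (P-bound n (≤-trans (n≤1+n 2) n≥3)) (≤-reflexive (sym (*-identityʳ _))))))
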